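{- The linear relaxation $\mathcal{LP}(C)$ with flow constraints of the min-max shortest path problem has an integrality gap of at least $\Omega(\sqrt{n})$, even for arc series-parallel graphs. That is, there exist a constant $c>0$ and an infinite family of instances $(G,s,t,\mathcal{U})$ of the min-max shortest path problem, in which $G$ is an arc series-parallel graph with source $s$ and sink $t$ and whose number of nodes $n$ is unbounded over the family, such that every instance of the family satisfies $C^*>0$ and $$\frac{OPT}{C^*}\ \ge\ c\,\sqrt{n}.$$
   Context: Min-max shortest path problem: given a directed graph $G=(V,E)$ (parallel arcs allowed), $|V|=n$, nodes $s,t\in V$, and a finite set $\mathcal{U}$ of $K$ distinct scenarios, each scenario $\xi\in\mathcal{U}$ being a vector $(c_e^{\xi})_{e\in E}$ of nonnegative integer arc costs, let $\Phi$ be the set of (arc sets of) $s$-$t$ paths in $G$ and $$OPT=\min_{X\in\Phi}\max_{\xi\in\mathcal{U}}\sum_{e\in X}c_e^{\xi}.$$ Linear relaxation: for a parameter $C$, let $E(C)=\{e\in E: c_e^{\xi}\le C \text{ for all }\xi\in\mathcal{U}\}$. Then $\mathcal{LP}(C)$ is the following system of linear constraints in $x=(x_e)_{e\in E}$: - $\sum_{e\in E}c_e^{\xi}x_e\le C$ for all $\xi\in\mathcal{U}$; - the flow constraints $\sum_{e\in\delta^{\mathrm{out}}(v)}x_e=\sum_{e\in\delta^{\mathrm{in}}(v)}x_e$ for all $v\in V\setminus\{s,t\}$, and $\sum_{e\in\delta^{\mathrm{out}}(s)}x_e=\sum_{e\in\delta^{\mathrm{in}}(t)}x_e=1$; - $x_e\in[0,1]$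 for $e\in E(C)$, and $x_e=0$ for $e\notin E(C)$. Here $\delta^{\mathrm{out}}(v)$ and $\delta^{\mathrm{in}}(v)$ are the sets of arcs leaving and entering $v$. $C^*$ denotes the smallest value of $C$ for which $\mathcal{LP}(C)$ is feasible (so $C^*\le OPT$). The integrality gap is the supremum over instances of $OPT/C^*$. Arc series-parallel graphs (with a source and a sink) are defined recursively: a graph consisting of two nodes joined by a single arc is arc series-parallel (its source is the tail and its sink the head of the arc); if $G_1,G_2$ are arc series-parallel with sources $s_1,s_2$ and sinks $t_1,t_2$, then so are the graphs obtained by parallel composition (identify $s_1$ with $s_2$ and $t_1$ with $t_2$) and by series composition (identify $t_1$ with $s_2$; the new source is $s_1$ and the new sink is $t_2$).
   Formalization: The parameter C and the flow variables x_e of LP(C) range over rational instead of real numbers, so C* is the smallest rational C with a rational feasible flow; as all costs are integers, this equals the real C*. -}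

module Defs where

open import Algebra.Bundles using (CommutativeMonoid)
import Algebra.Properties.CommutativeMonoid.Sum as Summation
open import Data.Bool.Base using (if_then_else_)
open import Data.Fin.Base using (Fin)
open import Data.Fin.Properties using (_≟_)
open import Data.Fin.Subset using (Subset; ⁅_⁆; ⋃)
import Data.Integer.Base as ℤ
open import Data.List.Base using (List; []; _∷_; map)
open import Data.List.Relation.Unary.Unique.Propositional using (Unique)
open import Data.Nat.Base as ℕ using (ℕ; NonZero)
import Data.Nat.Properties as ℕₚ
open import Data.Product.Base using (∃; ∃-syntax; _×_)
open import Data.Rational.Base as ℚ using (ℚ; 0ℚ; 1ℚ)
open import Data.Rational.Literals using (fromℤ)
import Data.Rational.Properties as ℚₚ
open import Data.Sum.Base using (_⊎_; inj₁; inj₂)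
import Data.Vec.Base as Vec
import Data.Vec.Functional as Vector
open import Function.Bundles using (_↔_; _⇔_; Inverse)
open import Function.Definitions using (Injective)
open import Relation.Binary.PropositionalEquality.Core using (_≡_; _≢_)
open import Relation.Nullary.Decidable.Core using (does)
open import Relation.Nullary.Negation.Core using (¬_)

fromℕ : ℕ → ℚ
fromℕ n = fromℤ (ℤ.+ n)

IsLeast : {A : Set} → (A → A → Set) → (A → Set) → A → Set
IsLeast _≤_ P a = P a × (∀ {b} → P b → a ≤ b)

-- c √n ≤ q for c ≥ 0, squared because ℚ has no square roots.
_√_≤_ : ℚ → ℕ → ℚ → Set
c √ n ≤ q = 0ℚ ℚ.≤ q × (c ℚ.* c) ℚ.* fromℕ n ℚ.≤ q ℚ.* q

module _ {a ℓ} (M : CommutativeMonoid a ℓ) where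
  open CommutativeMonoid M using (Carrier; ε)
  open Summation M using (sum)

  sumOver : ∀ {n} → Subset n → (Fin n → Carrier) → Carrier
  sumOver S f = sum (λ i → if Vec.lookup S i then f i else ε)

record Digraph : Set where
  field
    order     : ℕ
    size      : ℕ
    tail head : Fin size → Fin order

  Node Arc : Set
  Node = Fin order
  Arc  = Fin size

  δout δin : Node → Subset size
  δout v = Vec.tabulate (λ e → does (tail e ≟ v))
  δin  v = Vec.tabulate (λ e → does (head e ≟ v))

  data Walk : Node → Node → Set where
    nil  : ∀ {v} → Walk v v
    cons : ∀ {u v} (e : Arc) → tail e ≡ u → Walk (head e) v → Walk u v

  nodes : ∀ {u v} → Walk u v → List Node
  nodes {u} nil          = u ∷ []
  nodes {u} (cons _ _ w) = u ∷ nodes w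

  arcs : ∀ {u v} → Walk u v → List Arc
  arcs nil          = []
  arcs (cons e _ w) = e ∷ arcs w

  IsPath : ∀ {u v} → Walk u v → Set
  IsPath w = Unique (nodes w)

  arcSet : ∀ {u v} → Walk u v → Subset size
  arcSet w = ⋃ (map ⁅_⁆ (arcs w))

-- G is, up to isomorphism, the disjoint union of G₁ and G₂ in which v₁ and v₂
-- are identified whenever R v₁ v₂.  Both embeddings being injective, R must be
-- a partial bijection; this holds below because source and sink differ.
record Gluing (G₁ G₂ G : Digraph)
              (R : Digraph.Node G₁ → Digraph.Node G₂ → Set) : Set where
  private
    module G₁ = Digraph G₁
    module G₂ = Digraph G₂
    module G  = Digraph G
  field
    ι₁         : G₁.Node → G.Node
    ι₂         : G₂.Node → G.Node
    injective₁ : Injective _≡_ _≡_ ι₁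
    injective₂ : Injective _≡_ _≡_ ι₂
    identified : ∀ v₁ v₂ → (ι₁ v₁ ≡ ι₂ v₂) ⇔ R v₁ v₂
    covering   : ∀ v → (∃[ v₁ ] ι₁ v₁ ≡ v) ⊎ (∃[ v₂ ] ι₂ v₂ ≡ v)
    arcs       : (G₁.Arc ⊎ G₂.Arc) ↔ G.Arc
    tail₁      : ∀ e → G.tail (Inverse.to arcs (inj₁ e)) ≡ ι₁ (G₁.tail e)
    head₁      : ∀ e → G.head (Inverse.to arcs (inj₁ e)) ≡ ι₁ (G₁.head e)
    tail₂      : ∀ e → G.tail (Inverse.to arcs (inj₂ e)) ≡ ι₂ (G₂.tail e)
    head₂      : ∀ e → G.head (Inverse.to arcs (inj₂ e)) ≡ ι₂ (G₂.head e)

data ArcSeriesParallel : (G : Digraph) → Digraph.Node G → Digraph.Node G → Set where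

  single : ∀ {G} (e : Digraph.Arc G) →
           (∀ e′ → e′ ≡ e) →
           Digraph.tail G e ≢ Digraph.head G e →
           (∀ v → v ≡ Digraph.tail G e ⊎ v ≡ Digraph.head G e) →
           ArcSeriesParallel G (Digraph.tail G e) (Digraph.head G e)

  parallel : ∀ {G₁ G₂ G s₁ t₁ s₂ t₂} →
             ArcSeriesParallel G₁ s₁ t₁ →
             ArcSeriesParallel G₂ s₂ t₂ →
             (g : Gluing G₁ G₂ G
                    (λ v₁ v₂ → (v₁ ≡ s₁ × v₂ ≡ s₂) ⊎ (v₁ ≡ t₁ × v₂ ≡ t₂))) →
             ArcSeriesParallel G (Gluing.ι₁ g s₁) (Gluing.ι₁ g t₁)

  series : ∀ {G₁ G₂ G s₁ t₁ s₂ t₂} →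
           ArcSeriesParallel G₁ s₁ t₁ →
           ArcSeriesParallel G₂ s₂ t₂ →
           (g : Gluing G₁ G₂ G (λ v₁ v₂ → v₁ ≡ t₁ × v₂ ≡ s₂)) →
           ArcSeriesParallel G (Gluing.ι₁ g s₁) (Gluing.ι₂ g t₂)

record Instance : Set where
  field
    graph : Digraph
  open Digraph graph public
  field
    s t      : Node
    K        : ℕ
    K≢0      : NonZero K
    cost     : Fin K → Arc → ℕ
    distinct : ∀ ξ ξ′ → (∀ e → cost ξ e ≡ cost ξ′ e) → ξ ≡ ξ′

  Φ : Subset size → Set
  Φ X = ∃ λ (w : Walk s t) → IsPath w × X ≡ arcSet w

  -- The base value 0 is harmless: costs are nonnegative and K ≢ 0.
  maxCost : Subset size → ℕ
  maxCost X = Vector.foldr ℕ._⊔_ 0 λ ξ →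
    sumOver ℕₚ.+-0-commutativeMonoid X (cost ξ)

  IsOPT : ℕ → Set
  IsOPT = IsLeast ℕ._≤_ (λ v → ∃ λ X → Φ X × v ≡ maxCost X)

  E⟨_⟩ : ℚ → Arc → Set
  E⟨ C ⟩ e = ∀ ξ → fromℕ (cost ξ e) ℚ.≤ C

  open Summation ℚₚ.+-0-commutativeMonoid using (sum)

  outflow inflow : (Arc → ℚ) → Node → ℚ
  outflow x v = sumOver ℚₚ.+-0-commutativeMonoid (δout v) x
  inflow  x v = sumOver ℚₚ.+-0-commutativeMonoid (δin  v) x

  record LP (C : ℚ) (x : Arc → ℚ) : Set where
    field
      budget       : ∀ ξ → sum (λ e → fromℕ (cost ξ e) ℚ.* x e) ℚ.≤ C
      conservation : ∀ v → v ≢ s → v ≢ t → outflow x v ≡ inflow x v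
      source       : outflow x s ≡ 1ℚ
      sink         : inflow x t ≡ 1ℚ
      bounds       : ∀ e → E⟨ C ⟩ e → 0ℚ ℚ.≤ x e × x e ℚ.≤ 1ℚ
      excluded     : ∀ e → ¬ E⟨ C ⟩ e → x e ≡ 0ℚ

  -- Rational C and x lose nothing against real ones: E⟨ C ⟩ changes only at
  -- integers, so the real minimum is the optimum of a linear program with
  -- rational data (or an integer), attained at a rational point.
  IsC* : ℚ → Set
  IsC* = IsLeast ℚ._≤_ (λ C → ∃ (LP C))

{-# OPTIONS --safe #-}

-- Take m layers in series, each consisting of m parallel arcs, and one scenario
-- for every choice of an arc from each layer, in which exactly the chosen arcs
-- cost 1.  Every path is itself such a choice, so OPT = m, whereas the uniform
-- flow 1/m meets every scenario with cost 1; as every arc costs 1 in some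
-- scenario, E(C) is empty for C < 1, so C* = 1.  The gap m is even linear in
-- the number m + 1 of nodes.
module Submission where

open import Algebra.Bundles using (CommutativeMonoid)
import Algebra.Properties.CommutativeMonoid.Sum as Summation
open import Data.Bool.Base using (Bool; true; false; if_then_else_)
open import Data.Bool.Properties using (if-eta)
open import Data.Fin.Base
  using (Fin; zero; suc; toℕ; inject₁; _↑ˡ_; _↑ʳ_; combine; quotient; remainder;
         finToFun; funToFin)
  renaming (fromℕ to last)
open import Data.Fin.Induction using (>-weakInduction)
open import Data.Fin.Properties
  using (_≟_; remQuot-combine; combine-remQuot; *↔×; +↔⊎; toℕ-inject₁; inject₁-injective;
         suc-injective; toℕ-injective; toℕ-fromℕ; toℕ<n; ↑ˡ-injective; finToFun-funToFin;
         funToFin-finToFin)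
open import Data.Fin.Relation.Unary.Top using (view; ‵fromℕ; ‵inject₁)
open import Data.Fin.Subset using (Subset; _∈_)
open import Data.Fin.Subset.Properties using (x∈⁅x⁆; x∈p∪q⁺)
import Data.Integer.Base as ℤ
import Data.Integer.Properties as ℤₚ
open import Data.List.Relation.Unary.All as All using (All; []; _∷_)
open import Data.List.Relation.Unary.AllPairs.Core using ([]; _∷_)
open import Data.Nat.Base as ℕ using (ℕ; zero; suc; z≤n; s≤s)
import Data.Nat.Properties as ℕₚ
open import Data.Product.Algebra using (×-distribʳ-⊎)
open import Data.Product.Base using (Σ; ∃; Σ-syntax; ∃-syntax; _×_; _,_; proj₁; proj₂)
open import Data.Product.Function.NonDependent.Propositional using (_×-cong_)
open import Data.Rational.Base as ℚ using (ℚ; 0ℚ; 1ℚ; _÷_; >-nonZero; *≤*)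
import Data.Rational.Properties as ℚₚ
import Data.Rational.Unnormalised.Base as ℚᵘ
import Data.Rational.Unnormalised.Properties as ℚᵘₚ
open import Data.Sum.Base using (_⊎_; inj₁; inj₂)
open import Data.Sum.Function.Propositional using (_⊎-cong_)
import Data.Vec.Base as Vec
import Data.Vec.Functional as Vector
open import Data.Vec.Properties using (lookup∘tabulate; []=⇒lookup)
open import Function.Base using (_∘_; const)
open import Function.Bundles using (_↔_; Inverse; mk⇔)
open import Function.Construct.Composition using (_↔-∘_)
open import Function.Construct.Identity using (↔-id)
open import Function.Construct.Symmetry using (↔-sym)
open import Level using (0ℓ)
open import Relation.Binary.PropositionalEquality
  using (_≡_; _≢_; refl; sym; trans; cong; cong₂; subst; subst₂; module ≡-Reasoning)
open import Relation.Nullary.Decidable.Core using (Dec; does; yes; no)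
open import Relation.Nullary.Decidable using (does-⇔; dec-true)
open import Relation.Nullary.Negation.Core using (contradiction)
open import Defs

module Σℕ = Summation ℕₚ.+-0-commutativeMonoid
module Σℚ = Summation ℚₚ.+-0-commutativeMonoid

-- Sums over indices that encode pairs.

module _ {a ℓ} (M : CommutativeMonoid a ℓ) where
  open CommutativeMonoid M renaming (trans to ≈-trans; sym to ≈-sym; refl to ≈-refl)
  open Summation M
  open import Algebra.Definitions.RawMonoid rawMonoid using () renaming (_×_ to _·_)

  sum-++ : ∀ m {n} (f : Fin (m ℕ.+ n) → Carrier) →
           sum f ≈ sum (f ∘ (_↑ˡ n)) ∙ sum (f ∘ (m ↑ʳ_))
  sum-++ zero    f = ≈-sym (identityˡ _)
  sum-++ (suc m) f = ≈-trans (∙-congˡ (sum-++ m (f ∘ suc))) (≈-sym (assoc _ _ _))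

  sum-combine : ∀ m {n} (f : Fin (m ℕ.* n) → Carrier) →
                sum f ≈ sum {m} λ i → sum {n} λ j → f (combine i j)
  sum-combine zero        f = ≈-refl
  sum-combine (suc m) {n} f = ≈-trans (sum-++ n f) (∙-congˡ (sum-combine m (f ∘ (n ↑ʳ_))))

  sum-indicator : ∀ {n} (i : Fin n) x →
                  sum (λ j → if does (j ≟ i) then x else ε) ≈ x
  sum-indicator {suc n} zero    x = ≈-trans (∙-congˡ (sum-replicate-zero n)) (identityʳ x)
  sum-indicator {suc n} (suc i) x = ≈-trans (identityˡ _) (sum-indicator i x)

  -- With `combine h j` read as arc j of layer h, exactly the n arcs of layer i pass the test. It
  -- evaluates the flow through a node.
  sum-quotient : ∀ m n (i : Fin m) x →
                 sum {m ℕ.* n} (λ e → if does (quotient {m} n e ≟ i) then x else ε) ≈ n · x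
  sum-quotient m n i x = begin
    sum {m ℕ.* n} (λ e → if does (quotient {m} n e ≟ i) then x else ε)
      ≈⟨ sum-combine m _ ⟩
    sum {m} (λ h → sum {n} λ j → if does (quotient {m} n (combine h j) ≟ i) then x else ε)
      ≡⟨ sum-cong-≗ {m} (λ h → sum-cong-≗ {n} λ j →
           cong (λ p → if does (proj₁ p ≟ i) then x else ε) (remQuot-combine h j)) ⟩
    sum {m} (λ h → sum {n} λ j → if does (h ≟ i) then x else ε)
      ≈⟨ ∑-comm {m} {n} _ ⟩
    sum {n} (λ j → sum {m} λ h → if does (h ≟ i) then x else ε)
      ≈⟨ sum-cong-≋ {n} (λ _ → sum-indicator i x) ⟩
    sum {n} (λ _ → x)
      ≈⟨ sum-replicate n ⟩
    n · x ∎
    where open import Relation.Binary.Reasoning.Setoid setoid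

  -- Each layer has exactly one index on the graph of `f`. It evaluates both the total cost of a
  -- scenario and the budget used by the uniform flow.
  sum-graph : ∀ m n (f : Fin m → Fin n) x →
              sum {m ℕ.* n} (λ e → if does (remainder {m} n e ≟ f (quotient {m} n e)) then x else ε) ≈ m · x
  sum-graph m n f x = begin
    sum {m ℕ.* n} (λ e → if does (remainder {m} n e ≟ f (quotient {m} n e)) then x else ε)
      ≈⟨ sum-combine m _ ⟩
    sum {m} (λ i → sum {n} λ j →
      if does (remainder {m} n (combine i j) ≟ f (quotient {m} n (combine i j))) then x else ε)
      ≡⟨ sum-cong-≗ {m} (λ i → sum-cong-≗ {n} λ j →
           cong (λ p → if does (proj₂ p ≟ f (proj₁ p)) then x else ε) (remQuot-combine i j)) ⟩
    sum {m} (λ i → sum {n} λ j → if does (j ≟ f i) then x else ε)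
      ≈⟨ sum-cong-≋ {m} (λ i → sum-indicator (f i) x) ⟩
    sum {m} (λ _ → x)
      ≈⟨ sum-replicate m ⟩
    m · x ∎
    where open import Relation.Binary.Reasoning.Setoid setoid

-- Indicators, maxima and restricted sums.

does-true⇒ : ∀ {p} {P : Set p} (P? : Dec P) → does P? ≡ true → P
does-true⇒ (yes p) _ = p

indicator : Bool → ℕ
indicator b = if b then 1 else 0

indicator-true : ∀ {b} → indicator b ≡ 1 → b ≡ true
indicator-true {true} _ = refl

if-indicator : ∀ {a b} → (b ≡ true → a ≡ true) → (if a then indicator b else 0) ≡ indicator b
if-indicator {a} {false} _   = if-eta a
if-indicator {a} {true}  b⇒a rewrite b⇒a refl = refl

foldr-⊔-lub : ∀ {n b} {f : Fin n → ℕ} → (∀ i → f i ℕ.≤ b) → Vector.foldr ℕ._⊔_ 0 f ℕ.≤ b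
foldr-⊔-lub {zero}  f≤b = z≤n
foldr-⊔-lub {suc n} f≤b = ℕₚ.⊔-lub (f≤b zero) (foldr-⊔-lub (f≤b ∘ suc))

≤-foldr-⊔ : ∀ {n} (f : Fin n → ℕ) i → f i ℕ.≤ Vector.foldr ℕ._⊔_ 0 f
≤-foldr-⊔ f zero    = ℕₚ.m≤m⊔n _ _
≤-foldr-⊔ f (suc i) = ℕₚ.≤-trans (≤-foldr-⊔ (f ∘ suc) i) (ℕₚ.m≤n⊔m _ _)

sumOver-≤ : ∀ {n} (S : Subset n) (f : Fin n → ℕ) →
            sumOver ℕₚ.+-0-commutativeMonoid S f ℕ.≤ Σℕ.sum f
sumOver-≤ Vec.[]          f = z≤n
sumOver-≤ (true  Vec.∷ S) f = ℕₚ.+-monoʳ-≤ (f zero) (sumOver-≤ S (f ∘ suc))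
sumOver-≤ (false Vec.∷ S) f = ℕₚ.≤-trans (sumOver-≤ S (f ∘ suc)) (ℕₚ.m≤n+m _ (f zero))

-- The layered chain and its series-parallel structure.

chain : ℕ → ℕ → Digraph
chain m d = record
  { order = suc m
  ; size  = m ℕ.* d
  -- Arc `combine i j` is the j-th of the d parallel arcs from node i to node i + 1, so `quotient`
  -- reads off its layer.
  ; tail  = inject₁ ∘ quotient {m} d
  ; head  = suc ∘ quotient {m} d
  }

Fin1-irrelevant : (i j : Fin 1) → i ≡ j
Fin1-irrelevant zero zero = refl

-- Induction on the number of arcs: one more arc is put in parallel on the same two nodes, so both
-- embeddings are the identity.
bundle-seriesParallel : ∀ d → ArcSeriesParallel (chain 1 (suc d)) zero (suc zero)
bundle-seriesParallel zero    = single zero (λ e → Fin1-irrelevant e zero) (λ ())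
  λ { zero → inj₁ refl ; (suc zero) → inj₂ refl }
bundle-seriesParallel (suc d) = parallel (bundle-seriesParallel zero) (bundle-seriesParallel d) record
  { ι₁         = λ v → v
  ; ι₂         = λ v → v
  ; injective₁ = λ eq → eq
  ; injective₂ = λ eq → eq
  ; identified = λ v₁ v₂ → mk⇔ (split v₁ v₂) λ where
      (inj₁ (refl , refl)) → refl
      (inj₂ (refl , refl)) → refl
  ; covering   = λ v → inj₁ (v , refl)
  -- 1 * suc d reduces to suc (d + 0), so this bijection needs no casts.
  ; arcs       = ↔-sym +↔⊎
  ; tail₁      = λ _ → cong inject₁ (Fin1-irrelevant _ _)
  ; head₁      = λ _ → cong suc (Fin1-irrelevant _ _)
  ; tail₂      = λ _ → cong inject₁ (Fin1-irrelevant _ _)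
  ; head₂      = λ _ → cong suc (Fin1-irrelevant _ _)
  }
  where
  split : (v₁ v₂ : Fin 2) → v₁ ≡ v₂ → (v₁ ≡ zero × v₂ ≡ zero) ⊎ (v₁ ≡ suc zero × v₂ ≡ suc zero)
  split zero       v₂ refl = inj₁ (refl , refl)
  split (suc zero) v₂ refl = inj₂ (refl , refl)

-- Passing through products and distributivity keeps the position of an arc within its layer and
-- shifts the layers of the second summand by l, so the ends of an image follow from
-- `remQuot-combine`.
chain-arcs : ∀ l m d → (Fin (l ℕ.* d) ⊎ Fin (m ℕ.* d)) ↔ Fin ((l ℕ.+ m) ℕ.* d)
chain-arcs l m d =
  ↔-sym (*↔× {l ℕ.+ m}) ↔-∘ ((↔-sym +↔⊎ ×-cong ↔-id (Fin d)) ↔-∘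
    (↔-sym (×-distribʳ-⊎ 0ℓ (Fin d) (Fin l) (Fin m)) ↔-∘ (*↔× {l} ⊎-cong *↔× {m})))

-- The bundle is glued in front: the second embedding is then `suc`, and the source and sink of the
-- composition reduce to `zero` and `last`.
chain-seriesParallel : ∀ m d → ArcSeriesParallel (chain (suc m) (suc d)) zero (last (suc m))
chain-seriesParallel zero    d = bundle-seriesParallel d
chain-seriesParallel (suc m) d = series (bundle-seriesParallel d) (chain-seriesParallel m d) record
  { ι₁         = _↑ˡ suc m
  ; ι₂         = suc
  ; injective₁ = ↑ˡ-injective (suc m) _ _
  ; injective₂ = suc-injective
  ; identified = λ v₁ v₂ → mk⇔ (split v₁ v₂) λ { (refl , refl) → refl }
  ; covering   = λ { zero → inj₁ (zero , refl) ; (suc v) → inj₂ (v , refl) }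
  ; arcs       = chain-arcs 1 (suc m) (suc d)
  ; tail₁      = λ e → trans (cong inject₁ (quotient₁ e)) (inject₁-↑ˡ (quotient {1} (suc d) e))
  ; head₁      = λ e → cong suc (quotient₁ e)
  ; tail₂      = λ e → cong inject₁ (quotient₂ e)
  ; head₂      = λ e → cong suc (quotient₂ e)
  }
  where
  inject₁-↑ˡ : (i : Fin 1) → inject₁ (i ↑ˡ suc m) ≡ inject₁ i ↑ˡ suc m
  inject₁-↑ˡ zero = refl
  open Inverse (chain-arcs 1 (suc m) (suc d)) using (to)
  quotient₁ : ∀ e → quotient {2 ℕ.+ m} (suc d) (to (inj₁ e)) ≡ quotient {1} (suc d) e ↑ˡ suc m
  quotient₁ e = cong proj₁
    (remQuot-combine {2 ℕ.+ m} (quotient {1} (suc d) e ↑ˡ suc m) (remainder {1} (suc d) e))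
  quotient₂ : ∀ e → quotient {2 ℕ.+ m} (suc d) (to (inj₂ e)) ≡ suc (quotient {suc m} (suc d) e)
  quotient₂ e = cong proj₁
    (remQuot-combine {2 ℕ.+ m} (suc (quotient {suc m} (suc d) e)) (remainder {suc m} (suc d) e))
  split : ∀ v₁ v₂ → v₁ ↑ˡ suc m ≡ suc v₂ → v₁ ≡ suc zero × v₂ ≡ zero
  split (suc zero) zero refl = refl , refl

-- Walks in the chain.

module _ {m d : ℕ} where
  open Digraph (chain m d)

  toℕ-head : ∀ e → toℕ (head e) ≡ suc (toℕ (tail e))
  toℕ-head e = cong suc (sym (toℕ-inject₁ (quotient {m} d e)))

  nodes-≥ : ∀ {u v} (w : Walk u v) → All (λ x → toℕ u ℕ.≤ toℕ x) (nodes w)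
  nodes-≥ nil             = ℕₚ.≤-refl ∷ []
  nodes-≥ (cons e refl w) = ℕₚ.≤-refl ∷
    All.map (ℕₚ.≤-trans (ℕₚ.≤-trans (ℕₚ.n≤1+n _) (ℕₚ.≤-reflexive (sym (toℕ-head e))))) (nodes-≥ w)

  -- All nodes after the first are at least the head of the first arc, which exceeds its tail, so
  -- the first node never recurs.
  walk-isPath : ∀ {u v} (w : Walk u v) → IsPath w
  walk-isPath nil             = [] ∷ []
  walk-isPath (cons e refl w) =
    All.map (λ h≤x u≡x → ℕₚ.<⇒≢ (ℕₚ.<-≤-trans (ℕₚ.≤-reflexive (sym (toℕ-head e))) h≤x) (cong toℕ u≡x))
      (nodes-≥ w)
    ∷ walk-isPath w

  -- Arcs advance by a single node, so no layer can be jumped over: if the first arc is not in layer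
  -- i, its tail is strictly below i and its head still at most i. This makes every path contain a
  -- choice of one arc per layer.
  walk-crosses : ∀ {u v} (w : Walk u v) (i : Fin m) → toℕ u ℕ.≤ toℕ i → toℕ i ℕ.< toℕ v →
                 ∃[ e ] e ∈ arcSet w × quotient {m} d e ≡ i
  walk-crosses nil             i u≤i i<v = contradiction u≤i (ℕₚ.<⇒≱ i<v)
  walk-crosses (cons e refl w) i u≤i i<v with quotient {m} d e ≟ i
  ... | yes q≡i = e , x∈p∪q⁺ (inj₁ (x∈⁅x⁆ e)) , q≡i
  ... | no  q≢i =
    let q≤i = subst (ℕ._≤ toℕ i) (toℕ-inject₁ (quotient {m} d e)) u≤i
        e′ , e′∈w , q≡i = walk-crosses w i (ℕₚ.≤∧≢⇒< q≤i (q≢i ∘ toℕ-injective)) i<v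
    in  e′ , x∈p∪q⁺ (inj₂ e′∈w) , q≡i

-- Descending induction from the last node, prefixing arc 0 of each layer. It supplies a path
-- attaining OPT.
chain-walk : ∀ {m d} (v : Fin (suc m)) → Digraph.Walk (chain m (suc d)) v (last m)
chain-walk {m} {d} = >-weakInduction (λ v → Walk v (last m)) nil λ i w →
  cons (combine i zero) (cong (inject₁ ∘ proj₁) (remQuot-combine i zero))
    (subst (λ q → Walk (suc (proj₁ q)) (last m)) (sym (remQuot-combine i zero)) w)
  where open Digraph (chain m (suc d))

-- Natural numbers and natural multiples in ℚ.

fromℕ-+ : ∀ m n → fromℕ (m ℕ.+ n) ≡ fromℕ m ℚ.+ fromℕ n
fromℕ-+ m n = ℚₚ.toℚᵘ-injective (ℚᵘₚ.≃-trans
  (ℚᵘ.*≡* (cong (ℤ._* ℤ.+ 1) (sym (cong₂ ℤ._+_ (ℤₚ.*-identityʳ (ℤ.+ m)) (ℤₚ.*-identityʳ (ℤ.+ n))))))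
  (ℚᵘₚ.≃-sym (ℚₚ.toℚᵘ-homo-+ (fromℕ m) (fromℕ n))))

fromℕ-* : ∀ m n → fromℕ (m ℕ.* n) ≡ fromℕ m ℚ.* fromℕ n
fromℕ-* m n = ℚₚ.toℚᵘ-injective (ℚᵘₚ.≃-trans
  (ℚᵘ.*≡* (cong (ℤ._* ℤ.+ 1) (ℤₚ.pos-* m n)))
  (ℚᵘₚ.≃-sym (ℚₚ.toℚᵘ-homo-* (fromℕ m) (fromℕ n))))

fromℕ-mono-≤ : ∀ {m n} → m ℕ.≤ n → fromℕ m ℚ.≤ fromℕ n
fromℕ-mono-≤ m≤n = *≤* (ℤₚ.*-monoʳ-≤-nonNeg (ℤ.+ 1) (ℤ.+≤+ m≤n))

open import Algebra.Definitions.RawMonoid (CommutativeMonoid.rawMonoid ℚₚ.+-0-commutativeMonoid)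
  using () renaming (_×_ to _·_)
open import Algebra.Definitions.RawMonoid (CommutativeMonoid.rawMonoid ℕₚ.+-0-commutativeMonoid)
  using () renaming (_×_ to _·ℕ_)

-- Links the iterated addition left by the sum lemmas with multiplication in ℚ.
·≡fromℕ-* : ∀ n x → n · x ≡ fromℕ n ℚ.* x
·≡fromℕ-* zero    x = sym (ℚₚ.*-zeroˡ x)
·≡fromℕ-* (suc n) x = begin
  x ℚ.+ n · x                     ≡⟨ cong₂ ℚ._+_ (sym (ℚₚ.*-identityˡ x)) (·≡fromℕ-* n x) ⟩
  1ℚ ℚ.* x ℚ.+ fromℕ n ℚ.* x      ≡⟨ ℚₚ.*-distribʳ-+ x 1ℚ (fromℕ n) ⟨
  (1ℚ ℚ.+ fromℕ n) ℚ.* x          ≡⟨ cong (ℚ._* x) (fromℕ-+ 1 n) ⟨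
  fromℕ (suc n) ℚ.* x             ∎
  where open ≡-Reasoning

n·1/n≡1 : ∀ n → suc n · (ℚ.1/ fromℕ (suc n)) ≡ 1ℚ
n·1/n≡1 n = trans (·≡fromℕ-* (suc n) _) (ℚₚ.*-inverseʳ (fromℕ (suc n)))

n·ℕ1≡n : ∀ n → n ·ℕ 1 ≡ n
n·ℕ1≡n zero    = refl
n·ℕ1≡n (suc n) = cong suc (n·ℕ1≡n n)

-- The instance and its OPT.

module ChoiceInstance (n : ℕ) where
  -- A successor, so that every layer has an arc and `fromℕ m` is invertible.
  m : ℕ
  m = suc n

  -- `Fin (m ℕ.^ m)` enumerates all functions `Fin m → Fin m`; a scenario is thus a number that
  -- decodes to its choice of one arc per layer.
  choice : Fin (m ℕ.^ m) → Fin m → Fin m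
  choice = finToFun

  choice-funToFin : ∀ f i → choice (funToFin f) i ≡ f i
  choice-funToFin = finToFun-funToFin

  chosen : Fin (m ℕ.^ m) → Fin (m ℕ.* m) → Bool
  chosen ξ e = does (remainder {m} m e ≟ choice ξ (quotient {m} m e))

  chosen-combine : ∀ ξ i j → chosen ξ (combine i j) ≡ does (j ≟ choice ξ i)
  chosen-combine ξ i j = cong (λ p → does (proj₂ p ≟ choice ξ (proj₁ p))) (remQuot-combine i j)

  -- The arc that ξ chooses in layer i costs 1 under ξ, hence also under ξ′, which forces ξ′ to make
  -- the same choice there.
  chosen-injective : ∀ ξ ξ′ → (∀ e → indicator (chosen ξ e) ≡ indicator (chosen ξ′ e)) → ξ ≡ ξ′
  chosen-injective ξ ξ′ eq = begin
    ξ                    ≡⟨ funToFin-finToFin {m} {m} ξ ⟨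
    funToFin (choice ξ)  ≡⟨ funToFin-cong same ⟩
    funToFin (choice ξ′) ≡⟨ funToFin-finToFin {m} {m} ξ′ ⟩
    ξ′                   ∎
    where
    open ≡-Reasoning
    funToFin-cong : ∀ {l} {f g : Fin l → Fin m} → (∀ i → f i ≡ g i) → funToFin f ≡ funToFin g
    funToFin-cong {zero}  f≗g = refl
    funToFin-cong {suc l} f≗g = cong₂ combine (f≗g zero) (funToFin-cong (f≗g ∘ suc))
    same : ∀ i → choice ξ i ≡ choice ξ′ i
    same i = does-true⇒ (_ ≟ _) (indicator-true
      (trans (sym (cong indicator (chosen-combine ξ′ i (choice ξ i))))
      (trans (sym (eq (combine i (choice ξ i))))
      (cong indicator (trans (chosen-combine ξ i (choice ξ i)) (dec-true (choice ξ i ≟ choice ξ i) refl))))))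

  choiceInstance : Instance
  choiceInstance = record
    { graph    = chain m m
    ; s        = zero
    ; t        = last m
    ; K        = m ℕ.^ m
    ; K≢0      = ℕₚ.m^n≢0 m m
    ; cost     = λ ξ e → indicator (chosen ξ e)
    ; distinct = chosen-injective
    }

  open Instance choiceInstance

  totalCost : ∀ ξ → Σℕ.sum (cost ξ) ≡ m
  totalCost ξ = trans (sum-graph ℕₚ.+-0-commutativeMonoid m m (choice ξ) 1) (n·ℕ1≡n m)

  -- From above, no scenario charges more than m over all arcs together. From below, the scenario
  -- choosing in each layer an arc of the path charges the path its whole total m.
  maxCost-path : ∀ {X} → Φ X → maxCost X ≡ m
  maxCost-path {X} (w , _ , refl) = ℕₚ.≤-antisym
    (foldr-⊔-lub λ ξ → ℕₚ.≤-trans (sumOver-≤ X (cost ξ)) (ℕₚ.≤-reflexive (totalCost ξ)))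
    (ℕₚ.≤-trans (ℕₚ.≤-reflexive (sym attained))
      (≤-foldr-⊔ (λ ξ → sumOver ℕₚ.+-0-commutativeMonoid X (cost ξ)) worst))
    where
    crossing : ∀ i → ∃[ e ] e ∈ arcSet w × quotient {m} m e ≡ i
    crossing i = walk-crosses w i z≤n (subst (toℕ i ℕ.<_) (sym (toℕ-fromℕ m)) (toℕ<n i))
    used : Fin m → Fin m
    used i = remainder {m} m (proj₁ (crossing i))
    worst : Fin (m ℕ.^ m)
    worst = funToFin used
    combine-used : ∀ i → combine i (used i) ≡ proj₁ (crossing i)
    combine-used i with crossing i
    ... | e , _ , refl = combine-remQuot {m} m e
    used∈X : ∀ i → Vec.lookup X (combine i (used i)) ≡ true
    used∈X i = []=⇒lookup (subst (_∈ X) (sym (combine-used i)) (proj₁ (proj₂ (crossing i))))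
    -- Arcs of cost 1 under `worst` all lie in `X`, so restricting the sum to `X` drops only zeros.
    covered : ∀ e → (if Vec.lookup X e then cost worst e else 0) ≡ cost worst e
    covered e = if-indicator λ chosen≡true →
      trans (cong (Vec.lookup X) (trans (sym (combine-remQuot {m} m e))
        (cong (combine (quotient {m} m e)) (trans (does-true⇒ (_ ≟ _) chosen≡true) (choice-funToFin used _)))))
      (used∈X (quotient {m} m e))
    attained : sumOver ℕₚ.+-0-commutativeMonoid X (cost worst) ≡ m
    attained = trans (Σℕ.sum-cong-≗ covered) (totalCost worst)

  isOPT : IsOPT m
  isOPT = (arcSet w , path , sym (maxCost-path path))
        -- All paths have the same maximum cost, so minimality is an equality.
        , λ { (X , φ , refl) → ℕₚ.≤-reflexive (sym (maxCost-path φ)) }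
    where
    w = chain-walk zero
    path : Φ (arcSet w)
    path = w , walk-isPath w , refl

  -- The uniform flow and the value of C*.

  1/m : ℚ
  1/m = ℚ.1/ fromℕ m

  outflow-uniform : ∀ i → outflow (const 1/m) (inject₁ i) ≡ 1ℚ
  outflow-uniform i = begin
    outflow (const 1/m) (inject₁ i)
      ≡⟨ Σℚ.sum-cong-≗ (λ e → cong (if_then 1/m else 0ℚ)
           (trans (lookup∘tabulate (λ e → does (tail e ≟ inject₁ i)) e)
             -- Injectivity of `inject₁` turns the test on tails into the test on layers that
             -- `sum-quotient` expects.
             (does-⇔ (mk⇔ inject₁-injective (cong inject₁)) (tail e ≟ inject₁ i) (quotient {m} m e ≟ i)))) ⟩
    Σℚ.sum (λ e → if does (quotient {m} m e ≟ i) then 1/m else 0ℚ)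
      ≡⟨ sum-quotient ℚₚ.+-0-commutativeMonoid m m i 1/m ⟩
    m · 1/m
      ≡⟨ n·1/n≡1 n ⟩
    1ℚ ∎
    where open ≡-Reasoning

  inflow-uniform : ∀ i → inflow (const 1/m) (suc i) ≡ 1ℚ
  inflow-uniform i = begin
    inflow (const 1/m) (suc i)
      ≡⟨ Σℚ.sum-cong-≗ (λ e → cong (if_then 1/m else 0ℚ)
           (lookup∘tabulate (λ e → does (head e ≟ suc i)) e)) ⟩
    Σℚ.sum (λ e → if does (quotient {m} m e ≟ i) then 1/m else 0ℚ)
      ≡⟨ sum-quotient ℚₚ.+-0-commutativeMonoid m m i 1/m ⟩
    m · 1/m
      ≡⟨ n·1/n≡1 n ⟩
    1ℚ ∎
    where open ≡-Reasoning

  uniform-LP : LP 1ℚ (const 1/m)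
  uniform-LP = record
    { budget       = λ ξ → ℚₚ.≤-reflexive (budget ξ)
    ; conservation = λ v v≢s v≢t → trans (outflow≡1 v v≢t) (sym (inflow≡1 v v≢s))
    -- Here `s` is `inject₁ zero` and `t` is `suc (last n)`.
    ; source       = outflow-uniform zero
    ; sink         = inflow-uniform (last n)
    -- Cross-multiplied, 1/m ≤ 1 reads 1 ≤ m.
    ; bounds       = λ _ _ → ℚₚ.nonNegative⁻¹ 1/m , *≤* (ℤ.+≤+ (s≤s z≤n))
    -- All costs are at most 1, so `E⟨ 1ℚ ⟩` contains every arc.
    ; excluded     = λ e e∉ → contradiction (λ ξ → fromℕ-mono-≤ (cost≤1 ξ e)) e∉
    }
    where
    cost≤1 : ∀ ξ e → cost ξ e ℕ.≤ 1
    cost≤1 ξ e with chosen ξ e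
    ... | true  = ℕₚ.≤-refl
    ... | false = z≤n
    scaled : ∀ b → fromℕ (indicator b) ℚ.* 1/m ≡ (if b then 1/m else 0ℚ)
    scaled true  = ℚₚ.*-identityˡ 1/m
    scaled false = ℚₚ.*-zeroˡ 1/m
    budget : ∀ ξ → Σℚ.sum (λ e → fromℕ (cost ξ e) ℚ.* 1/m) ≡ 1ℚ
    budget ξ = trans (Σℚ.sum-cong-≗ (λ e → scaled (chosen ξ e)))
      (trans (sum-graph ℚₚ.+-0-commutativeMonoid m m (choice ξ) 1/m) (n·1/n≡1 n))
    outflow≡1 : ∀ v → v ≢ t → outflow (const 1/m) v ≡ 1ℚ
    outflow≡1 v v≢t with view v
    ... | ‵fromℕ     = contradiction refl v≢t
    ... | ‵inject₁ i = outflow-uniform i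
    inflow≡1 : ∀ v → v ≢ s → inflow (const 1/m) v ≡ 1ℚ
    inflow≡1 zero    v≢s = contradiction refl v≢s
    inflow≡1 (suc i) v≢s = inflow-uniform i

  -- For C < 1 every arc is excluded, since some scenario charges it 1; then no flow leaves the
  -- source, against the required unit.
  1≤feasible : ∀ {C} → ∃ (LP C) → 1ℚ ℚ.≤ C
  1≤feasible {C} (x , lp) with 1ℚ ℚₚ.≤? C
  ... | yes 1≤C = 1≤C
  ... | no  1≰C = contradiction (trans (sym (LP.source lp)) no-flow) λ ()
    where
    x≡0 : ∀ e → x e ≡ 0ℚ
    x≡0 e = LP.excluded lp e λ e∈ → 1≰C (subst (λ c → fromℕ c ℚ.≤ C) cost≡1 (e∈ ξ))
      where
      -- Choosing the position of `e` in every layer makes `e` itself a chosen arc.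
      ξ = funToFin {m} (const (remainder {m} m e))
      cost≡1 : cost ξ e ≡ 1
      cost≡1 = cong indicator
        (dec-true (_ ≟ _) (sym (choice-funToFin (const (remainder {m} m e)) (quotient {m} m e))))
    no-flow : outflow x s ≡ 0ℚ
    no-flow = trans
      (Σℚ.sum-cong-≗ λ e →
        trans (cong (if Vec.lookup (δout s) e then_else 0ℚ) (x≡0 e)) (if-eta (Vec.lookup (δout s) e)))
      (Σℚ.sum-replicate-zero size)

  isC* : IsC* 1ℚ
  isC* = (const 1/m , uniform-LP) , 1≤feasible

proposition1 : Σ[ c ∈ ℚ ] (0ℚ ℚ.< c) × (Σ[ I ∈ (ℕ → Instance) ]
    (∀ N → ∃[ k ] (N ℕ.≤ Instance.order (I k))) ×
    (∀ k → let open Instance (I k) in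
    ArcSeriesParallel graph s t ×
    (∃[ OPT ] ∃[ C* ] IsOPT OPT × IsC* C* ×
    (Σ[ C*>0 ∈ (C* ℚ.> 0ℚ) ]
    (c √ order ≤ (_÷_ (fromℕ OPT) C* {{>-nonZero C*>0}}))))))
-- At least two layers are taken so that m + 1 ≤ m², which allows c = 1.
proposition1 = 1ℚ , 0<1 , choiceInstance ∘ suc , (λ N → N , ℕₚ.m≤n+m N 3) , λ k →
  let m = 2 ℕ.+ k
      m÷1≡m = ℚₚ.*-identityʳ (fromℕ m)
  in chain-seriesParallel (suc k) (suc k) , m , 1ℚ , isOPT (suc k) , isC* (suc k) , 0<1 ,
     -- After dividing by C* = 1, the squared form of the bound is m + 1 ≤ m².
     subst (1ℚ √ suc m ≤_) (sym m÷1≡m)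
       ( fromℕ-mono-≤ z≤n
       , subst₂ ℚ._≤_ (sym (ℚₚ.*-identityˡ (fromℕ (suc m)))) (fromℕ-* m m) (fromℕ-mono-≤ (1+m≤m*m k)))
  where
  open ChoiceInstance
  0<1 : 0ℚ ℚ.< 1ℚ
  0<1 = ℚₚ.positive⁻¹ 1ℚ
  1+m≤m*m : ∀ k → 3 ℕ.+ k ℕ.≤ (2 ℕ.+ k) ℕ.* (2 ℕ.+ k)
  -- With m = 2 + k: 1 + m ≤ m + m ≤ m + (m + k m) = m².
  1+m≤m*m k = ℕₚ.≤-trans (ℕₚ.+-monoˡ-≤ (2 ℕ.+ k) {1} {2 ℕ.+ k} (s≤s z≤n))
    (ℕₚ.+-monoʳ-≤ (2 ℕ.+ k) (ℕₚ.m≤m+n (2 ℕ.+ k) (k ℕ.* (2 ℕ.+ k))))
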